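{- Let $H$ be a weighted graph with weight function $\mathrm{wt}$ on its edges, and let $G$ be a cellular completion of $H$. Let $H'$ be the complement of $H$ with respect to $G$, equipped with the derived weight $\mathrm{wt}'$. Then $$ M(H;\mathrm{wt})=2^{|\mathcal C_0|}\left(\prod_{c\in\mathcal C_1}\Delta(c)\right)M(H';\mathrm{wt}'), $$ where $\mathcal C_1$ and $\mathcal C_0$ are the sets of whole and partial cells, respectively.
   Context: All graphs are finite. The weight of a perfect matching of a weighted graph is the product of the weights of its edges, and the matching generating function $M(G;\mathrm{wt})$ is the sum of the weights of all perfect matchings. A cellular graph is a finite graph $G$ whose edge set is partitioned into 4-cycles (the cells of $G$) such that each vertex is contained in at most two cells; every vertex is assumed to lie in at least one cell. The set $X(G)$ of extremal vertices of $G$ is the set of vertices contained in exactly one cell (these are the vertices at which the lines of cells, obtained by passing repeatedly to the opposite vertex of a cell and then to the other cell containing that vertex, terminate). Given a weighted graph $H$, a weighted cellular graph $G$ is a cellular completion of $H$ if (i) $H$ is a (weighted) subgraph of $G$, and all edges of $E(G)\setminus E(H)$ with both endpoints in $V(H)$ have weight $0$ in $G$; and (ii) $V(G)\setminus V(H)\subseteq X(G)$. The weights of the edges of $H$ are independent indeterminates, and everything takes place in the field of rational functions in them. For a cell $c$ of $G$, consider the set of endpoints of those edges of $H$ that are contained in $c$. The cell is called whole if this set consists of all four vertices of $c$, and partial otherwise. Standing assumptions: each cell of $G$ contains at least one edge of $H$, and each vertex of a cell $c$ that belongs to $V(H)$ is an endpoint of some edge of $H$ contained in $c$. If the whole cell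 $c$ has edges weighted $x,y,z,w$ in cyclic order (edges of $c$ not in $H$ have weight $0$), its cell-factor is $\Delta(c)=xz+yw$, which is nonzero. The complement $H'$ of $H$ with respect to $G$ is the induced subgraph of $G$ whose vertex set is the symmetric difference $V(H')=V(H)\,\triangle\,X(G)$. Define a new weight $\mathrm{wt}_1$ on the edges of $G$, cell by cell. If $c$ is whole, then for each edge $e$ of $c$ set $\mathrm{wt}_1(e)=\mathrm{wt}(f)/\Delta(c)$, where $f$ is the edge opposite $e$ in $c$. If $c$ is a partial cell with vertices $A,B,C,D$ in cyclic order, whose edges in $H$ are $AB$ of weight $x$ and $BC$ of weight $y$ (so $D\notin V(H)$), set $\mathrm{wt}_1(AB)=\frac{1}{2x}$, $\mathrm{wt}_1(BC)=\frac1{2y}$, $\mathrm{wt}_1(CD)=\frac x2$, $\mathrm{wt}_1(DA)=\frac y2$. If $c$ is a partial cell with vertices $A,B,C,D$ in cyclic order, whose only edge in $H$ is $AB$, of weight $x$ (so $C,D\notin V(H)$), set $\mathrm{wt}_1(AB)=\frac1{2x}$, $\mathrm{wt}_1(CD)=\frac x2$, $\mathrm{wt}_1(BC)=\mathrm{wt}_1(DA)=\frac12$. The derived weight $\mathrm{wt}'$ on $H'$ is the restriction of $\mathrm{wt}_1$ to the edges of $H'$ (edges of weight $0$ contribute nothing to $M(H';\mathrm{wt}')$). -}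

module Defs where

open import Level using (Level; _⊔_) renaming (suc to lsuc)
open import Algebra.Apartness.Bundles using (HeytingField)
open import Algebra.Bundles using (CommutativeRing; Semiring)
import Algebra.Apartness.Properties.HeytingCommutativeRing as HeytingProperties
import Algebra.Definitions.RawSemiring as RawSemiringDefs
open import Data.Empty using (⊥; ⊥-elim)
open import Data.Fin.Base using (Fin)
open import Data.Fin.Patterns using (0F; 1F; 2F; 3F)
open import Data.Fin.Properties using (any?; all?) renaming (_≟_ to _≟ᶠ_)
open import Data.Fin.Subset using (Subset; inside; outside; _∈_; _∉_; _⊆_; _∪_; _─_)
open import Data.Fin.Subset.Properties using (_∈?_; _⊆?_)
open import Data.Integer.Base using (ℤ; +_; -[1+_]; 0ℤ; 1ℤ)
open import Data.List.Base using (List; []; _∷_; _++_; map; filter; foldr; length; allFin)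
open import Data.List.Relation.Binary.Permutation.Propositional using (_↭_)
open import Data.List.Relation.Binary.Permutation.Propositional.Properties using (∈-resp-↭)
open import Data.List.Relation.Unary.All using ([]; _∷_)
open import Data.List.Relation.Unary.AllPairs using (AllPairs; []; _∷_)
open import Data.List.Relation.Unary.Any using (Any; here; there)
open import Data.Nat.Base using (ℕ; zero; suc; _≤_)
import Data.Nat.Properties as ℕ
open import Data.Product.Base using (∃-syntax; _×_; _,_; proj₁; proj₂; uncurry)
open import Data.Product.Properties using (,-injectiveʳ)
open import Data.Sum.Base using (_⊎_; inj₁; inj₂)
open import Data.Vec.Base using (tabulate; []; _∷_)
open import Data.Vec.Properties using (lookup∘tabulate; []=⇒lookup)
open import Function.Base using (_∘_)
open import Function.Definitions using (Injective; Bijective)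
open import Relation.Binary.PropositionalEquality as ≡ using (_≡_; _≢_)
open import Relation.Nullary using (Dec; yes; no; does; proof; Reflects; invert; ¬_; contradiction)
open import Relation.Nullary.Decidable using (_×-dec_; _⊎-dec_; _→-dec_; ¬?)
open import Relation.Unary using (Decidable)

------------------------------------------------------------------------
-- Fields of rational functions

-- A monomial is a multiset of indeterminates, i.e. a list up to _↭_.
Monomial : Set → Set
Monomial I = List I

record Polynomial (I : Set) : Set where
  constructor poly
  field
    terms    : List (ℤ × Monomial I)
    distinct : AllPairs (λ s t → ¬ (proj₂ s ↭ proj₂ t)) terms

open Polynomial public

-- The monomials listed are pairwise distinct, so a polynomial is nonzero
-- exactly when one of the listed coefficients is.
Nonzero : {I : Set} → Polynomial I → Set
Nonzero p = Any (λ t → proj₁ t ≢ 0ℤ) (terms p)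

module FieldOps {a ℓ₁ ℓ₂ : Level} (K : HeytingField a ℓ₁ ℓ₂) where

  open HeytingField K
  open HeytingProperties heytingCommutativeRing using (x#0y#0→xy#0)

  ring : CommutativeRing a ℓ₁
  ring = record { isCommutativeRing = isCommutativeRing }

  open RawSemiringDefs (Semiring.rawSemiring (CommutativeRing.semiring ring)) public
    using (_^_) renaming (_×_ to _·_)

  2# : Carrier
  2# = 1# + 1#

  infix 8 _⁻¹[_]

  -- The library states invertibility for the difference y - 0#.
  _⁻¹[_] : (y : Carrier) → y # 0# → Carrier
  y ⁻¹[ y#0 ] = proj₁ (#⇒invertible y#0)

  *-#0 : ∀ {x y} → x # 0# → y # 0# → x * y # 0#
  *-#0 = x#0y#0→xy#0

  module _ {I : Set} (var : I → Carrier) where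

    ⟦_⟧ᶻ : ℤ → Carrier
    ⟦ + n ⟧ᶻ      = n · 1#
    ⟦ -[1+ n ] ⟧ᶻ = - (suc n · 1#)

    ⟦_⟧ᵐ : Monomial I → Carrier
    ⟦ m ⟧ᵐ = foldr (λ i s → var i * s) 1# m

    ⟦_⟧ᵗ : List (ℤ × Monomial I) → Carrier
    ⟦ ts ⟧ᵗ = foldr (λ t s → ⟦ proj₁ t ⟧ᶻ * ⟦ proj₂ t ⟧ᵐ + s) 0# ts

    ⟦_⟧ : Polynomial I → Carrier
    ⟦ p ⟧ = ⟦ terms p ⟧ᵗ

-- The field ℚ(var i : i ∈ I), characterised up to isomorphism: the var i
-- are algebraically independent over ℤ (which forces characteristic 0), and
-- every element is a quotient of two integer polynomials in them.
record RationalFunctionField (I : Set) (a ℓ₁ ℓ₂ : Level)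
       : Set (lsuc (a ⊔ ℓ₁ ⊔ ℓ₂)) where
  field
    heytingField : HeytingField a ℓ₁ ℓ₂

  open HeytingField heytingField public
  open FieldOps heytingField public

  field
    var         : I → Carrier
    independent : ∀ (p : Polynomial I) → Nonzero p → ⟦_⟧ var p # 0#
    generated   : ∀ (k : Carrier) →
                  ∃[ p ] ∃[ q ] Nonzero q × ⟦_⟧ var q * k ≈ ⟦_⟧ var p

module RationalFunctionProperties {I : Set} {a ℓ₁ ℓ₂ : Level}
       (K : RationalFunctionField I a ℓ₁ ℓ₂) where

  open RationalFunctionField K
  open HeytingProperties heytingCommutativeRing using (#-congʳ)

  private
    one-term : ∀ m → ⟦ var ⟧ᵗ ((1ℤ , m) ∷ []) ≈ ⟦ var ⟧ᵐ m
    one-term m = trans (+-identityʳ _)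
                   (trans (*-congʳ (+-identityʳ 1#)) (*-identityˡ _))

    two-terms : ∀ m n →
                ⟦ var ⟧ᵗ ((1ℤ , m) ∷ (1ℤ , n) ∷ []) ≈ ⟦ var ⟧ᵐ m + ⟦ var ⟧ᵐ n
    two-terms m n = +-cong (trans (*-congʳ (+-identityʳ 1#)) (*-identityˡ _))
                           (one-term n)

    pair : ∀ i j → ⟦ var ⟧ᵐ (i ∷ j ∷ []) ≈ var i * var j
    pair i j = *-congˡ (*-identityʳ (var j))

  var#0 : ∀ i → var i # 0#
  var#0 i = #-congʳ (trans (one-term (i ∷ [])) (*-identityʳ (var i)))
              (independent (poly ((1ℤ , i ∷ []) ∷ []) ([] ∷ [])) (here λ ()))

  2#0 : 2# # 0#
  2#0 = #-congʳ (trans (+-identityʳ _) (trans (*-identityʳ _)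
                  (+-congˡ (+-identityʳ 1#))))
          (independent (poly ((+ 2 , []) ∷ []) ([] ∷ [])) (here λ ()))

  var*var+var*var#0 : ∀ {i j k l} → i ≢ k → i ≢ l →
                      var i * var j + var k * var l # 0#
  var*var+var*var#0 {i} {j} {k} {l} i≢k i≢l =
    #-congʳ (trans (two-terms (i ∷ j ∷ []) (k ∷ l ∷ [])) (+-cong (pair i j) (pair k l)))
      (independent (poly ((1ℤ , i ∷ j ∷ []) ∷ (1ℤ , k ∷ l ∷ []) ∷ [])
                         ((distinct′ ∷ []) ∷ [] ∷ []))
                   (here λ ()))
    where
    distinct′ : ¬ (i ∷ j ∷ [] ↭ k ∷ l ∷ [])
    distinct′ π with ∈-resp-↭ π (here ≡.refl)
    ... | here i≡k         = i≢k i≡k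
    ... | there (here i≡l) = i≢l i≡l

------------------------------------------------------------------------
-- Graphs and perfect matchings

-- Finite graphs without loops; parallel edges are allowed.
record Graph : Set where
  field
    #V #E    : ℕ
    ends     : Fin #E → Fin #V × Fin #V
    loopless : ∀ e → proj₁ (ends e) ≢ proj₂ (ends e)

module _ (G : Graph) where

  open Graph G

  Joins : Fin #E → Fin #V → Fin #V → Set
  Joins e u v = ends e ≡ (u , v) ⊎ ends e ≡ (v , u)

  Incident : Fin #E → Fin #V → Set
  Incident e v = v ≡ proj₁ (ends e) ⊎ v ≡ proj₂ (ends e)

  incident? : ∀ e v → Dec (Incident e v)
  incident? e v = (v ≟ᶠ proj₁ (ends e)) ⊎-dec (v ≟ᶠ proj₂ (ends e))

  record Subgraph : Set where
    field
      V      : Subset #V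
      E      : Subset #E
      closed : ∀ {e} → e ∈ E → proj₁ (ends e) ∈ V × proj₂ (ends e) ∈ V

open Subgraph public

module _ {G : Graph} where

  open Graph G

  Edge : Subgraph G → Set
  Edge S = ∃[ e ] e ∈ E S

  induced : Subset #V → Subgraph G
  induced W = record { V = W ; E = tabulate (does ∘ inW?) ; closed = closed′ }
    where
    inW? : ∀ e → Dec (proj₁ (ends e) ∈ W × proj₂ (ends e) ∈ W)
    inW? e = (proj₁ (ends e) ∈? W) ×-dec (proj₂ (ends e) ∈? W)

    closed′ : ∀ {e} → e ∈ tabulate (does ∘ inW?) →
              proj₁ (ends e) ∈ W × proj₂ (ends e) ∈ W
    closed′ {e} e∈ = invert (≡.subst (Reflects _)
      (≡.trans (≡.sym (lookup∘tabulate (does ∘ inW?) e)) ([]=⇒lookup e∈))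
      (proof (inW? e)))

  IsPerfectMatching : Subgraph G → Subset #E → Set
  IsPerfectMatching S T =
    T ⊆ E S ×
    (∀ v → v ∈ V S →
       ∃[ e ] (e ∈ T × Incident G e v) ×
              (∀ f → f ∈ T × Incident G f v → f ≡ e))

  isPerfectMatching? : ∀ S → Decidable (IsPerfectMatching S)
  isPerfectMatching? S T =
    (T ⊆? E S) ×-dec
    all? λ v → (v ∈? V S) →-dec
      any? λ e → ((e ∈? T) ×-dec incident? G e v) ×-dec
        all? λ f → ((f ∈? T) ×-dec incident? G f v) →-dec (f ≟ᶠ e)

subsets : ∀ n → List (Subset n)
subsets zero    = [] ∷ []
subsets (suc n) = map (inside ∷_) (subsets n) ++ map (outside ∷_) (subsets n)

module Matchings {a ℓ : Level} (R : CommutativeRing a ℓ) where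

  open CommutativeRing R

  ∑ ∏ : {A : Set} → List A → (A → Carrier) → Carrier
  ∑ xs f = foldr (λ x s → f x + s) 0# xs
  ∏ xs f = foldr (λ x s → f x * s) 1# xs

  -- Only the weights of the edges of S matter.
  M : {G : Graph} → Subgraph G → (Fin (Graph.#E G) → Carrier) → Carrier
  M {G} S wt =
    ∑ (filter (isPerfectMatching? S) (subsets #E)) λ T →
      ∏ (filter (_∈? T) (allFin #E)) wt
    where open Graph G

------------------------------------------------------------------------
-- Cellular graphs

next opp : Fin 4 → Fin 4
next 0F = 1F
next 1F = 2F
next 2F = 3F
next 3F = 0F
opp = next ∘ next

-- Side i of a cell joins its corners i and next i, so the corners and the
-- sides are both listed in cyclic order, and sides i and opp i are opposite.
record Cellular (G : Graph) : Set where
  open Graph G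
  field
    #C               : ℕ
    corner           : Fin #C → Fin 4 → Fin #V
    side             : Fin #C → Fin 4 → Fin #E
    corner-injective : ∀ c → Injective _≡_ _≡_ (corner c)
    side-joins       : ∀ c i → Joins G (side c i) (corner c i) (corner c (next i))
    partition        : Bijective _≡_ _≡_ (uncurry side)

  cellsAt : Fin #V → List (Fin #C)
  cellsAt v = filter (λ c → any? λ i → corner c i ≟ᶠ v) (allFin #C)

  field
    at-least-one : ∀ v → 1 ≤ length (cellsAt v)
    at-most-two  : ∀ v → length (cellsAt v) ≤ 2

  extremal : Subset #V
  extremal = tabulate λ v → does (length (cellsAt v) ℕ.≟ 1)

  position : Fin #E → Fin #C × Fin 4
  position e = proj₁ (proj₂ partition e)

-- The edges of H are weighted by the indeterminates of K.
record CellularCompletion {G : Graph} {a ℓ₁ ℓ₂ : Level} (H : Subgraph G)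
       (K : RationalFunctionField (Edge H) a ℓ₁ ℓ₂) : Set (a ⊔ ℓ₁) where
  open Graph G
  open RationalFunctionField K
  field
    cellular     : Cellular G
    wt           : Fin #E → Carrier
    wt-H         : ∀ e (e∈H : e ∈ E H) → wt e ≈ var (e , e∈H)
    wt-zero      : ∀ e → e ∉ E H → proj₁ (ends e) ∈ V H → proj₂ (ends e) ∈ V H →
                   wt e ≈ 0#
    new⊆extremal : ∀ v → v ∉ V H → v ∈ Cellular.extremal cellular

module Completion {G : Graph} {a ℓ₁ ℓ₂ : Level} {H : Subgraph G}
       {K : RationalFunctionField (Edge H) a ℓ₁ ℓ₂}
       (𝒢 : CellularCompletion H K) where

  open Graph G
  open RationalFunctionField K public
  open RationalFunctionProperties K
  open HeytingProperties heytingCommutativeRing using (#-congʳ)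
  open CellularCompletion 𝒢 public
  open Cellular cellular public
  open Matchings ring public

  -- Corner i of c is an endpoint of an edge of H contained in c.
  Covered : Fin #C → Fin 4 → Set
  Covered c i = ∃[ j ] side c j ∈ E H × Incident G (side c j) (corner c i)

  Whole : Fin #C → Set
  Whole c = ∀ i → Covered c i

  whole? : Decidable Whole
  whole? c = all? λ i → any? λ j →
               (side c j ∈? E H) ×-dec incident? G (side c j) (corner c i)

  EveryCellMeetsH : Set
  EveryCellMeetsH = ∀ c → ∃[ i ] side c i ∈ E H

  VerticesCoveredInCells : Set
  VerticesCoveredInCells = ∀ c i → corner c i ∈ V H → Covered c i

  𝒞₁ 𝒞₀ : List (Fin #C)
  𝒞₁ = filter whole? (allFin #C)
  𝒞₀ = filter (λ c → ¬? (whole? c)) (allFin #C)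

  Δ : Fin #C → Carrier
  Δ c = wt (side c 0F) * wt (side c 2F) + wt (side c 1F) * wt (side c 3F)

  wt#0 : ∀ {e} → e ∈ E H → wt e # 0#
  wt#0 {e} e∈H = #-congʳ (sym (wt-H e e∈H)) (var#0 (e , e∈H))

  ends-of-side : ∀ c j {v} → Incident G (side c j) v →
                 v ≡ corner c j ⊎ v ≡ corner c (next j)
  ends-of-side c j inc with side-joins c j | inc
  ... | inj₁ eq | inj₁ v≡ = inj₁ (≡.trans v≡ (≡.cong proj₁ eq))
  ... | inj₁ eq | inj₂ v≡ = inj₂ (≡.trans v≡ (≡.cong proj₂ eq))
  ... | inj₂ eq | inj₁ v≡ = inj₂ (≡.trans v≡ (≡.cong proj₁ eq))
  ... | inj₂ eq | inj₂ v≡ = inj₁ (≡.trans v≡ (≡.cong proj₂ eq))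

  covering-side : ∀ {c i} → Covered c (next i) →
                  side c i ∈ E H ⊎ side c (next i) ∈ E H
  covering-side {c} {i} (j , j∈H , inc) with ends-of-side c j inc
  ... | inj₁ eq = inj₂ (≡.subst (λ k → side c k ∈ E H)
                          (≡.sym (corner-injective c eq)) j∈H)
  ... | inj₂ eq = inj₁ (≡.subst (λ k → side c k ∈ E H)
                          (≡.sym (next-injective (corner-injective c eq))) j∈H)
    where
    next⁴ : ∀ i → opp (opp i) ≡ i
    next⁴ 0F = ≡.refl
    next⁴ 1F = ≡.refl
    next⁴ 2F = ≡.refl
    next⁴ 3F = ≡.refl

    next-injective : ∀ {i j} → next i ≡ next j → i ≡ j
    next-injective {i} {j} eq =
      ≡.trans (≡.sym (next⁴ i)) (≡.trans (≡.cong (next ∘ opp) eq) (next⁴ j))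

  corner∈V : ∀ {c i} → Covered c i → corner c i ∈ V H
  corner∈V (j , j∈H , inj₁ eq) = ≡.subst (_∈ V H) (≡.sym eq) (proj₁ (closed H j∈H))
  corner∈V (j , j∈H , inj₂ eq) = ≡.subst (_∈ V H) (≡.sym eq) (proj₂ (closed H j∈H))

  wt-whole-zero : ∀ {c} → Whole c → ∀ i → side c i ∉ E H → wt (side c i) ≈ 0#
  wt-whole-zero {c} w i ∉H with side-joins c i
  ... | inj₁ eq = wt-zero _ ∉H
                    (≡.subst (_∈ V H) (≡.sym (≡.cong proj₁ eq)) (corner∈V (w i)))
                    (≡.subst (_∈ V H) (≡.sym (≡.cong proj₂ eq)) (corner∈V (w (next i))))
  ... | inj₂ eq = wt-zero _ ∉H
                    (≡.subst (_∈ V H) (≡.sym (≡.cong proj₁ eq)) (corner∈V (w (next i))))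
                    (≡.subst (_∈ V H) (≡.sym (≡.cong proj₂ eq)) (corner∈V (w i)))

  Both : Fin #C → Fin 4 → Set
  Both c i = side c i ∈ E H × side c (opp i) ∈ E H

  both? : ∀ c i → Dec (Both c i)
  both? c i = (side c i ∈? E H) ×-dec (side c (opp i) ∈? E H)

  product : Fin #C → Fin 4 → Carrier
  product c i = wt (side c i) * wt (side c (opp i))

  product-zero : ∀ {c} → Whole c → ∀ i → ¬ Both c i → product c i ≈ 0#
  product-zero {c} w i ¬both with side c i ∈? E H
  ... | no  ∉H = trans (*-congʳ (wt-whole-zero w i ∉H)) (zeroˡ _)
  ... | yes ∈H = trans (*-congˡ (wt-whole-zero w (opp i) (λ ∈H′ → ¬both (∈H , ∈H′))))
                       (zeroʳ _)

  product#0 : ∀ {c i} → Both c i → product c i # 0#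
  product#0 (p , q) = *-#0 (wt#0 p) (wt#0 q)

  opposite-pair : ∀ {c} → Whole c → ¬ Both c 0F → ¬ Both c 1F → ⊥
  opposite-pair w ¬b₀ ¬b₁
    with covering-side {i = 0F} (w 1F) | covering-side {i = 1F} (w 2F)
       | covering-side {i = 2F} (w 3F) | covering-side {i = 3F} (w 0F)
  ... | inj₁ p | _      | inj₁ q | _      = contradiction (p , q) ¬b₀
  ... | inj₁ p | inj₂ q | inj₂ _ | _      = contradiction (p , q) ¬b₀
  ... | inj₁ _ | inj₁ p | inj₂ q | _      = contradiction (p , q) ¬b₁
  ... | inj₂ p | _      | inj₂ q | _      = contradiction (p , q) ¬b₁
  ... | inj₂ p | _      | inj₁ _ | inj₁ q = contradiction (p , q) ¬b₁
  ... | inj₂ _ | _      | inj₁ p | inj₂ q = contradiction (q , p) ¬b₀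

  side≢ : ∀ c {i j} {p : side c i ∈ E H} {q : side c j ∈ E H} → i ≢ j →
          _≢_ {A = Edge H} (side c i , p) (side c j , q)
  side≢ c i≢j eq = i≢j (,-injectiveʳ (proj₁ partition {c , _} {c , _} (≡.cong proj₁ eq)))

  Δ#0 : ∀ c → Whole c → Δ c # 0#
  Δ#0 c w with both? c 0F | both? c 1F
  ... | yes (p , q) | yes (r , s) =
    #-congʳ (sym (+-cong (*-cong (wt-H _ p) (wt-H _ q)) (*-cong (wt-H _ r) (wt-H _ s))))
      (var*var+var*var#0 (side≢ c λ ()) (side≢ c λ ()))
  ... | yes b₀ | no ¬b₁ =
    #-congʳ (sym (trans (+-congˡ (product-zero w 1F ¬b₁)) (+-identityʳ _))) (product#0 b₀)
  ... | no ¬b₀ | yes b₁ =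
    #-congʳ (sym (trans (+-congʳ (product-zero w 0F ¬b₀)) (+-identityˡ _))) (product#0 b₁)
  ... | no ¬b₀ | no ¬b₁ = ⊥-elim (opposite-pair w ¬b₀ ¬b₁)

  -- In a partial cell, one rule covers both patterns of H-edges:
  --   an edge of H of weight x         gets 1/(2x);
  --   the edge opposite to such an edge gets x/2;
  --   any remaining edge               gets 1/2.
  -- With H-edges AB, BC this gives 1/(2x), 1/(2y), x/2, y/2 on AB, BC, CD, DA;
  -- with the single H-edge AB it gives 1/(2x), 1/2, x/2, 1/2.
  -- Two opposite sides are never both in H here: the cell would be whole.
  partialWeight : ∀ {e f} → Dec (e ∈ E H) → Dec (f ∈ E H) → Carrier
  partialWeight {e} (yes e∈H) _       = (2# * wt e) ⁻¹[ *-#0 2#0 (wt#0 e∈H) ]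
  partialWeight {f = f} (no _) (yes _) = wt f * 2# ⁻¹[ 2#0 ]
  partialWeight         (no _) (no _)  = 2# ⁻¹[ 2#0 ]

  sideWeight : ∀ c i → Dec (Whole c) → Carrier
  sideWeight c i (yes w) = wt (side c (opp i)) * Δ c ⁻¹[ Δ#0 c w ]
  sideWeight c i (no  _) =
    partialWeight (side c i ∈? E H) (side c (opp i) ∈? E H)

  wt₁ : Fin #E → Carrier
  wt₁ e = let c , i = position e in sideWeight c i (whole? c)

  H′ : Subgraph G
  H′ = induced ((V H ─ extremal) ∪ (extremal ─ V H))

module Submission where

-- Record, for a perfect matching and every cell, the set of corners matched inside that cell. A
-- vertex in two cells is matched inside exactly one of them, an extremal vertex is matched inside its
-- cell iff it lies in the graph; so complementing all these sets exchanges the records possible for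
-- V H with those possible for V H ∆ X(G). The generating function is the sum over the records of
-- products of local matching sums, and it remains to compare a single cell: the local sum for a set S
-- of corners under wt is Δ(c) (whole cell) or 2 (partial cell) times the one for the complement of S
-- under wt₁.

open import Defs
open import Algebra.Bundles using (CommutativeMonoid; CommutativeRing; Semiring)
import Algebra.Definitions.RawSemiring as RawSemiringDefs
import Algebra.Properties.CommutativeSemigroup as CommutativeSemigroupProperties
import Algebra.Properties.Ring as RingProperties
import Algebra.Solver.Ring.NaturalCoefficients.Default as Solver
open import Data.Bool.Base using (true; false; if_then_else_; not)
open import Data.Bool.Properties using (not-involutive)
open import Data.Empty using (⊥-elim)
open import Data.Fin.Base using (Fin; zero; suc)
open import Data.Fin.Patterns using (0F; 1F; 2F; 3F)
open import Data.Fin.Properties using (any?; all?; ¬∀⟶∃¬) renaming (_≟_ to _≟ᶠ_)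
open import Data.Fin.Subset using (Subset; inside; outside; _∈_; _∉_; _∪_; _─_; ⊤; ⊥; ⁅_⁆; ∁)
open import Data.Fin.Subset.Properties
  using (_∈?_; ∈⊤; x∈⁅x⁆; x∈p∪q⁻; x∈p∪q⁺; x∉p⇒x∈∁p; x∈∁p⇒x∉p; x∈p∧x∉q⇒x∈p─q)
open import Data.List.Base
  using (List; []; _∷_; _++_; map; filter; foldr; length; allFin; cartesianProductWith)
import Data.List.Membership.Propositional as List
open import Data.List.Membership.Propositional.Properties
  using (∈-cartesianProductWith⁺; ∈-map⁺; ∈-allFin; ∈-filter⁺; ∈-filter⁻)
open import Data.List.Membership.Propositional.Properties.WithK using (unique∧set⇒bag)
open import Data.List.Properties using (map-tabulate; ++-identityʳ)
open import Data.List.Relation.Binary.BagAndSetEquality using (∼bag⇒↭)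
open import Data.List.Relation.Binary.Permutation.Propositional using (_↭_; prep; swap)
import Data.List.Relation.Binary.Permutation.Propositional as Perm
open import Data.List.Relation.Unary.All using ([]; _∷_)
open import Data.List.Relation.Unary.AllPairs using ([]; _∷_)
open import Data.List.Relation.Unary.Any using (here; there)
open import Data.List.Relation.Unary.Unique.Propositional using (Unique)
import Data.List.Relation.Unary.Unique.Propositional.Properties as Unique
open import Data.Nat.Base using (zero; suc; _≤_; s≤s)
import Data.Nat.Properties as ℕ
open import Data.Product.Base using (_×_; _,_; proj₁; proj₂; ∃-syntax; uncurry)
open import Data.Product.Properties using (≡-dec; ,-injective)
open import Data.Sum.Base using (_⊎_; inj₁; inj₂)
open import Data.Vec.Base as Vec using (Vec; []; _∷_; here; there; lookup; tabulate)
open import Data.Vec.Properties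
  using (∷-injective; lookup∘tabulate; []=⇒lookup; lookup⇒[]=; lookup-map; tabulate-cong; tabulate∘lookup;
         map-∘; map-id; map-cong)
open import Function.Base using (_∘_; id)
open import Function.Bundles using (_⇔_; mk⇔; module Equivalence)
open import Level using (Level)
open import Relation.Binary.PropositionalEquality as ≡ using (_≡_; _≢_)
open import Relation.Nullary using (Dec; does; proof; Reflects; invert; yes; no; ¬_; contradiction)
open import Relation.Nullary.Decidable
  using (does-⇔; dec-true; dec-false; from-yes; _×-dec_; _⊎-dec_; _→-dec_; ¬?)
open import Relation.Unary using (Pred; Decidable)

-- Enumerations and finite sums

private
  variable
    a : Level
    A B C : Set a

vectors : List A → ∀ n → List (Vec A n)
vectors xs zero    = [] ∷ []
vectors xs (suc n) = cartesianProductWith _∷_ xs (vectors xs n)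

vectors-complete : {xs : List A} → (∀ x → x List.∈ xs) → ∀ {n} (v : Vec A n) → v List.∈ vectors xs n
vectors-complete all []      = here ≡.refl
vectors-complete all (x ∷ v) = ∈-cartesianProductWith⁺ _∷_ (all x) (vectors-complete all v)

vectors-unique : {xs : List A} → Unique xs → ∀ n → Unique (vectors xs n)
vectors-unique u zero    = [] ∷ []
vectors-unique u (suc n) = Unique.cartesianProductWith⁺ _∷_ ∷-injective u (vectors-unique u n)

subsets≡vectors : ∀ n → subsets n ≡ vectors (inside ∷ outside ∷ []) n
subsets≡vectors zero    = ≡.refl
subsets≡vectors (suc n) = ≡.cong₂ (λ xs ys → map (inside ∷_) xs ++ ys) (subsets≡vectors n)
  (≡.trans (≡.cong (map (outside ∷_)) (subsets≡vectors n)) (≡.sym (++-identityʳ _)))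

subsets-complete : ∀ {n} (T : Subset n) → T List.∈ subsets n
subsets-complete {n} T = ≡.subst (T List.∈_) (≡.sym (subsets≡vectors n))
  (vectors-complete (λ { true → here ≡.refl ; false → there (here ≡.refl) }) T)

subsets-unique : ∀ n → Unique (subsets n)
subsets-unique n = ≡.subst Unique (≡.sym (subsets≡vectors n))
  (vectors-unique (((λ ()) ∷ []) ∷ [] ∷ []) n)

-- Turns a bijection between index sets into a change of index in a finite sum or product: both
-- enumerations list everything exactly once.
complete-↭ : {xs ys : List A} → Unique xs → Unique ys →
             (∀ x → x List.∈ xs) → (∀ x → x List.∈ ys) → xs ↭ ys
complete-↭ u v all-xs all-ys =
  ∼bag⇒↭ (unique∧set⇒bag u v (mk⇔ (λ _ → all-ys _) (λ _ → all-xs _)))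

module BigOp {c ℓ} (M : CommutativeMonoid c ℓ) where

  open CommutativeMonoid M
  open import Relation.Binary.Reasoning.Setoid setoid

  big : List A → (A → Carrier) → Carrier
  big xs f = foldr (λ x s → f x ∙ s) ε xs

  big-cong : ∀ (xs : List A) {f g : A → Carrier} → (∀ x → f x ≈ g x) → big xs f ≈ big xs g
  big-cong []       eq = refl
  big-cong (x ∷ xs) eq = ∙-cong (eq x) (big-cong xs eq)

  big-ε : ∀ (xs : List A) {f : A → Carrier} → (∀ x → f x ≈ ε) → big xs f ≈ ε
  big-ε []       eq = refl
  big-ε (x ∷ xs) eq = trans (∙-cong (eq x) (big-ε xs eq)) (identityˡ ε)

  big-↭ : ∀ {xs ys : List A} (f : A → Carrier) → xs ↭ ys → big xs f ≈ big ys f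
  big-↭ f Perm.refl = refl
  big-↭ f (prep x π) = ∙-congˡ (big-↭ f π)
  big-↭ f (swap {xs} {ys} x y π) = begin
    f x ∙ (f y ∙ big xs f) ≈⟨ ∙-congˡ (∙-congˡ (big-↭ f π)) ⟩
    f x ∙ (f y ∙ big ys f) ≈⟨ assoc _ _ _ ⟨
    f x ∙ f y ∙ big ys f   ≈⟨ ∙-congʳ (comm _ _) ⟩
    f y ∙ f x ∙ big ys f   ≈⟨ assoc _ _ _ ⟩
    f y ∙ (f x ∙ big ys f) ∎
  big-↭ f (Perm.trans π ρ) = trans (big-↭ f π) (big-↭ f ρ)

  big-map : ∀ (h : A → B) xs (f : B → Carrier) → big (map h xs) f ≈ big xs (f ∘ h)
  big-map h []       f = refl
  big-map h (x ∷ xs) f = ∙-congˡ (big-map h xs f)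

  big-++ : ∀ (xs ys : List A) f → big (xs ++ ys) f ≈ big xs f ∙ big ys f
  big-++ []       ys f = sym (identityˡ _)
  big-++ (x ∷ xs) ys f = trans (∙-congˡ (big-++ xs ys f)) (sym (assoc _ _ _))

  big-cartesianProductWith : ∀ (h : A → B → C) xs ys f →
    big (cartesianProductWith h xs ys) f ≈ big xs (λ x → big ys (λ y → f (h x y)))
  big-cartesianProductWith h []       ys f = refl
  big-cartesianProductWith h (x ∷ xs) ys f = trans (big-++ (map (h x) ys) _ f)
    (∙-cong (big-map (h x) ys f) (big-cartesianProductWith h xs ys f))

  big-filter : ∀ {p} {P : Pred A p} (P? : Decidable P) xs f →
    big (filter P? xs) f ≈ big xs (λ x → if does (P? x) then f x else ε)
  big-filter P? []       f = refl
  big-filter P? (x ∷ xs) f with does (P? x)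
  ... | true  = ∙-congˡ (big-filter P? xs f)
  ... | false = trans (big-filter P? xs f) (sym (identityˡ _))

  big-allFin : ∀ n (f : Fin (suc n) → Carrier) →
    big (allFin (suc n)) f ≈ f zero ∙ big (allFin n) (f ∘ suc)
  big-allFin n f = ∙-congˡ (trans
    (reflexive (≡.cong (λ xs → big xs f) (≡.sym (map-tabulate id suc))))
    (big-map suc (allFin n) f))

-- Sides and corners of a 4-cycle

next≢id : ∀ i → next i ≢ i
next≢id 0F ()
next≢id 1F ()
next≢id 2F ()
next≢id 3F ()

opp-involutive : ∀ i → opp (opp i) ≡ i
opp-involutive 0F = ≡.refl
opp-involutive 1F = ≡.refl
opp-involutive 2F = ≡.refl
opp-involutive 3F = ≡.refl

next-injective : ∀ {i j} → next i ≡ next j → i ≡ j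
next-injective {i} {j} eq = ≡.trans (≡.sym (opp-involutive i))
  (≡.trans (≡.cong (next ∘ opp) eq) (opp-involutive j))

-- A Subset 4 is a set of sides or a set of corners of a 4-cycle; side j has the corners j and next j.
Touches : Fin 4 → Fin 4 → Set
Touches j i = i ≡ j ⊎ i ≡ next j

-- Used to show that a cell with two opposite sides in `H` is whole.
opposite-sides-touch : ∀ i k → Touches i k ⊎ Touches (opp i) k
opposite-sides-touch = from-yes (all? λ i → all? λ k →
  ((k ≟ᶠ i) ⊎-dec (k ≟ᶠ next i)) ⊎-dec ((k ≟ᶠ opp i) ⊎-dec (k ≟ᶠ next (opp i))))

rotate : Subset 4 → Subset 4
rotate (a ∷ b ∷ c ∷ d ∷ []) = d ∷ a ∷ b ∷ c ∷ []

lookup-rotate : ∀ t i → lookup (rotate t) (next i) ≡ lookup t i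
lookup-rotate (a ∷ b ∷ c ∷ d ∷ []) 0F = ≡.refl
lookup-rotate (a ∷ b ∷ c ∷ d ∷ []) 1F = ≡.refl
lookup-rotate (a ∷ b ∷ c ∷ d ∷ []) 2F = ≡.refl
lookup-rotate (a ∷ b ∷ c ∷ d ∷ []) 3F = ≡.refl

-- With `t` read as a set of sides, these are their corners: side `j` contributes `j` through `t`
-- and `next j` through `rotate t`.
covered : Subset 4 → Subset 4
covered t = t ∪ rotate t

∈-covered⁺ : ∀ {t i j} → j ∈ t → Touches j i → i ∈ covered t
∈-covered⁺ j∈t (inj₁ ≡.refl) = x∈p∪q⁺ (inj₁ j∈t)
∈-covered⁺ {t} {j = j} j∈t (inj₂ ≡.refl) = x∈p∪q⁺ (inj₂
  (lookup⇒[]= _ _ (≡.trans (lookup-rotate t j) ([]=⇒lookup j∈t))))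

∈-covered⁻ : ∀ t {i} → i ∈ covered t → ∃[ j ] j ∈ t × Touches j i
∈-covered⁻ t {i} i∈ with x∈p∪q⁻ t (rotate t) i∈
... | inj₁ i∈t = i , i∈t , inj₁ ≡.refl
... | inj₂ i∈r = next (opp i) , lookup⇒[]= _ _ (≡.trans (≡.sym (lookup-rotate t _))
                   (≡.trans (≡.cong (lookup (rotate t)) (opp-involutive i)) ([]=⇒lookup i∈r)))
               , inj₂ (≡.sym (opp-involutive i))

-- The matchings of the 4-cycle, as sets of sides.
NonAdjacent : Subset 4 → Set
NonAdjacent t = ∀ i → i ∈ t → next i ∉ t

nonAdjacent? : Decidable NonAdjacent
nonAdjacent? t = all? λ i → (i ∈? t) →-dec ¬? (next i ∈? t)

touches-unique : ∀ {t} → NonAdjacent t → ∀ {i j k} → j ∈ t → k ∈ t →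
                 Touches j i → Touches k i → j ≡ k
touches-unique na j∈t k∈t (inj₁ ≡.refl) (inj₁ ≡.refl) = ≡.refl
touches-unique na j∈t k∈t (inj₁ ≡.refl) (inj₂ ≡.refl) = contradiction j∈t (na _ k∈t)
touches-unique na j∈t k∈t (inj₂ ≡.refl) (inj₁ ≡.refl) = contradiction k∈t (na _ j∈t)
touches-unique na j∈t k∈t (inj₂ ≡.refl) (inj₂ eq)     = next-injective eq

-- Membership in induced subgraphs, complements and differences

∈-induced : ∀ {G : Graph} (W : Subset (Graph.#V G)) {e} →
            proj₁ (Graph.ends G e) ∈ W → proj₂ (Graph.ends G e) ∈ W → e ∈ E (induced {G} W)
∈-induced W {e} p q = lookup⇒[]= e _ (≡.trans (lookup∘tabulate _ e)
  (dec-true ((_ ∈? W) ×-dec (_ ∈? W)) (p , q)))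

∁-involutive : ∀ {n} (p : Subset n) → ∁ (∁ p) ≡ p
∁-involutive p = ≡.trans (≡.sym (map-∘ not not p))
  (≡.trans (map-cong not-involutive p) (map-id p))

x∈q⇒x∉p─q : ∀ {n} {p q : Subset n} {x} → x ∈ q → x ∉ p ─ q
x∈q⇒x∉p─q {p = _ ∷ _} {inside ∷ _} here ()
x∈q⇒x∉p─q {p = _ ∷ _} {_ ∷ _} (there x∈q) (there x∈d) = x∈q⇒x∉p─q x∈q x∈d

lookup-ext : ∀ {n} (u v : Vec A n) → (∀ i → lookup u i ≡ lookup v i) → u ≡ v
lookup-ext u v eq = ≡.trans (≡.sym (tabulate∘lookup u))
  (≡.trans (tabulate-cong eq) (tabulate∘lookup v))

∈⇔∈ : ∀ {m n} {p : Subset m} {q : Subset n} {i j} → lookup p i ≡ lookup q j → (i ∈ p) ⇔ (j ∈ q)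
∈⇔∈ {i = i} {j} eq = mk⇔
  (λ i∈p → lookup⇒[]= j _ (≡.trans (≡.sym eq) ([]=⇒lookup i∈p)))
  (λ j∈q → lookup⇒[]= i _ (≡.trans eq ([]=⇒lookup j∈q)))

-- Configurations of a cellular graph

module Configurations {G : Graph} (𝒢 : Cellular G) where

  open Graph G
  open Cellular 𝒢
  open Equivalence using (to; from)

  Config : Set
  Config = Vec (Subset 4) #C

  Place : Set
  Place = Fin #C × Fin 4

  cornerAt : Place → Fin #V
  cornerAt = uncurry corner

  sideAt : Place → Fin #E
  sideAt = uncurry side

  sideAt-injective : ∀ {p q} → sideAt p ≡ sideAt q → p ≡ q
  sideAt-injective = proj₁ partition

  sideAt-position : ∀ e → sideAt (position e) ≡ e
  sideAt-position e = proj₂ (proj₂ partition e) ≡.refl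

  position-sideAt : ∀ p → position (sideAt p) ≡ p
  position-sideAt p = sideAt-injective (sideAt-position (sideAt p))

  edge-view : ∀ e → ∃[ c ] ∃[ i ] side c i ≡ e
  edge-view e = proj₁ (position e) , proj₂ (position e) , sideAt-position e

  On : Config → Place → Set
  On t (c , i) = i ∈ lookup t c

  -- Since the cells partition the edges, this is a bijection from choices of sides in each cell to
  -- edge sets of `G`.
  glue : Config → Subset #E
  glue t = tabulate λ e → let c , i = position e in lookup (lookup t c) i

  lookup-glue : ∀ t p → lookup (glue t) (sideAt p) ≡ lookup (lookup t (proj₁ p)) (proj₂ p)
  lookup-glue t p = ≡.trans (lookup∘tabulate _ (sideAt p))
    (≡.cong (λ q → lookup (lookup t (proj₁ q)) (proj₂ q)) (position-sideAt p))

  ∈-glue : ∀ t c i → (side c i ∈ glue t) ⇔ (i ∈ lookup t c)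
  ∈-glue t c i = ∈⇔∈ (lookup-glue t (c , i))

  glue-injective : ∀ {s t} → glue s ≡ glue t → s ≡ t
  glue-injective {s} {t} eq = lookup-ext s t λ c → lookup-ext _ _ λ i →
    ≡.trans (≡.sym (lookup-glue s (c , i)))
      (≡.trans (≡.cong (λ T → lookup T (side c i)) eq) (lookup-glue t (c , i)))

  glue-surjective : ∀ T → ∃[ t ] glue t ≡ T
  glue-surjective T = t , lookup-ext _ _ λ e →
    ≡.trans (lookup∘tabulate _ e)
      (≡.trans (entry (position e)) (≡.cong (lookup T) (sideAt-position e)))
    where
    t : Config
    t = tabulate λ c → tabulate λ i → lookup T (side c i)

    entry : ∀ p → lookup (lookup t (proj₁ p)) (proj₂ p) ≡ lookup T (sideAt p)
    entry (c , i) = ≡.trans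
      (≡.cong (λ s → lookup s i) (lookup∘tabulate (λ d → tabulate λ j → lookup T (side d j)) c))
      (lookup∘tabulate (λ j → lookup T (side c j)) i)

  touches-incident : ∀ c {j i} → Touches j i → Incident G (side c j) (corner c i)
  touches-incident c {j} t with side-joins c j | t
  ... | inj₁ eq | inj₁ ≡.refl = inj₁ (≡.sym (≡.cong proj₁ eq))
  ... | inj₁ eq | inj₂ ≡.refl = inj₂ (≡.sym (≡.cong proj₂ eq))
  ... | inj₂ eq | inj₁ ≡.refl = inj₂ (≡.sym (≡.cong proj₂ eq))
  ... | inj₂ eq | inj₂ ≡.refl = inj₁ (≡.sym (≡.cong proj₁ eq))

  incident-touches : ∀ c {j v} → Incident G (side c j) v → ∃[ i ] corner c i ≡ v × Touches j i
  incident-touches c {j} inc with side-joins c j | inc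
  ... | inj₁ eq | inj₁ ≡.refl = j , ≡.sym (≡.cong proj₁ eq) , inj₁ ≡.refl
  ... | inj₁ eq | inj₂ ≡.refl = next j , ≡.sym (≡.cong proj₂ eq) , inj₂ ≡.refl
  ... | inj₂ eq | inj₁ ≡.refl = next j , ≡.sym (≡.cong proj₁ eq) , inj₂ ≡.refl
  ... | inj₂ eq | inj₂ ≡.refl = j , ≡.sym (≡.cong proj₂ eq) , inj₁ ≡.refl

  incident∈V : (S : Subgraph G) → ∀ {e v} → e ∈ E S → Incident G e v → v ∈ V S
  incident∈V S e∈S (inj₁ ≡.refl) = proj₁ (closed S e∈S)
  incident∈V S e∈S (inj₂ ≡.refl) = proj₂ (closed S e∈S)

  -- Here b is the set of corners matched inside each cell, whereas glue reads a Config as sets of sides.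
  Exact : Subset #V → Config → Set
  Exact W b =
    (∀ v → v ∈ W → ∃[ c ] ∃[ i ] (corner c i ≡ v × On b (c , i)) ×
                     (∀ d j → corner d j ≡ v × On b (d , j) → (d , j) ≡ (c , i))) ×
    (∀ c i → On b (c , i) → corner c i ∈ W)

  exact? : ∀ W → Decidable (Exact W)
  exact? W b =
    (all? λ v → (v ∈? W) →-dec
      any? λ c → any? λ i → ((corner c i ≟ᶠ v) ×-dec (i ∈? lookup b c)) ×-dec
        all? λ d → all? λ j → ((corner d j ≟ᶠ v) ×-dec (j ∈? lookup b d)) →-dec
          ≡-dec _≟ᶠ_ _≟ᶠ_ (d , j) (c , i))
    ×-dec
    (all? λ c → all? λ i → (i ∈? lookup b c) →-dec (corner c i ∈? W))

  on-map : ∀ (f : Subset 4 → Subset 4) t c i → On (Vec.map f t) (c , i) ⇔ (i ∈ f (lookup t c))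
  on-map f t c i = ∈⇔∈ (≡.cong (λ s → lookup s i) (lookup-map c f t))

  on-covered⁺ : ∀ t c {i j} → j ∈ lookup t c → Touches j i → On (Vec.map covered t) (c , i)
  on-covered⁺ t c j∈t touch = from (on-map covered t c _) (∈-covered⁺ j∈t touch)

  on-covered⁻ : ∀ t c {i} → On (Vec.map covered t) (c , i) → ∃[ j ] j ∈ lookup t c × Touches j i
  on-covered⁻ t c on = ∈-covered⁻ _ (to (on-map covered t c _) on)

  -- Splits being a perfect matching into a local condition on each cell and a global one that sees
  -- only the sets of covered corners. The converse is `exact⇒perfect`.
  perfect⇒exact : ∀ W t → IsPerfectMatching (induced {G} W) (glue t) →
                  Exact W (Vec.map covered t) × (∀ c → NonAdjacent (lookup t c))
  perfect⇒exact W t (T⊆E , perfect) = (exists , supported) , nonAdjacent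
    where
    supported : ∀ c i → On (Vec.map covered t) (c , i) → corner c i ∈ W
    supported c i on with on-covered⁻ t c on
    ... | j , j∈t , touch =
      incident∈V (induced W) (T⊆E (from (∈-glue t c j) j∈t)) (touches-incident c touch)

    exists : ∀ v → v ∈ W → ∃[ c ] ∃[ i ] (corner c i ≡ v × On (Vec.map covered t) (c , i)) ×
               (∀ d k → corner d k ≡ v × On (Vec.map covered t) (d , k) → (d , k) ≡ (c , i))
    exists v v∈W with perfect v v∈W
    ... | e , (e∈T , inc) , unique with edge-view e
    ... | c , j , ≡.refl with incident-touches c inc
    ... | i , ≡.refl , touch =
      c , i , (≡.refl , on-covered⁺ t c (to (∈-glue t c j) e∈T) touch) , only
      where
      only : ∀ d k → corner d k ≡ corner c i × On (Vec.map covered t) (d , k) → (d , k) ≡ (c , i)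
      only d k (eq , on) with on-covered⁻ t d on
      ... | l , l∈t , touch′ with sideAt-injective (unique (side d l)
              ( from (∈-glue t d l) l∈t
              , ≡.subst (Incident G (side d l)) eq (touches-incident d touch′)))
      ... | ≡.refl = ≡.cong (c ,_) (corner-injective c eq)

    nonAdjacent : ∀ c → NonAdjacent (lookup t c)
    nonAdjacent c j j∈t j′∈t
      -- Sides `j` and `next j` share the corner `next j`, which only one matching edge may meet.
      with perfect (corner c (next j)) (supported c (next j) (on-covered⁺ t c j∈t (inj₂ ≡.refl)))
    ... | e , _ , unique = next≢id j (≡.cong proj₂ (sideAt-injective (≡.trans
            (unique _ (from (∈-glue t c _) j′∈t , touches-incident c (inj₁ ≡.refl)))
            (≡.sym (unique _ (from (∈-glue t c _) j∈t , touches-incident c (inj₂ ≡.refl)))))))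

  exact⇒perfect : ∀ W t → Exact W (Vec.map covered t) → (∀ c → NonAdjacent (lookup t c)) →
                  IsPerfectMatching (induced {G} W) (glue t)
  exact⇒perfect W t (exists , supported) nonAdjacent = T⊆E , perfect
    where
    T⊆E : ∀ {e} → e ∈ glue t → e ∈ E (induced {G} W)
    T⊆E {e} e∈T with edge-view e
    ... | c , j , ≡.refl = ∈-induced {G} W (end (inj₁ ≡.refl)) (end (inj₂ ≡.refl))
      where
      end : ∀ {v} → Incident G (side c j) v → v ∈ W
      end inc with incident-touches c inc
      ... | i , ≡.refl , touch = supported c i (on-covered⁺ t c (to (∈-glue t c j) e∈T) touch)

    perfect : ∀ v → v ∈ W → ∃[ e ] (e ∈ glue t × Incident G e v) ×
                (∀ f → f ∈ glue t × Incident G f v → f ≡ e)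
    perfect v v∈W with exists v v∈W
    ... | c , i , (≡.refl , on) , unique with on-covered⁻ t c on
    ... | j , j∈t , touch = side c j , (from (∈-glue t c j) j∈t , touches-incident c touch) , only
      where
      only : ∀ f → f ∈ glue t × Incident G f (corner c i) → f ≡ side c j
      only f (f∈T , inc) with edge-view f
      ... | d , k , ≡.refl with incident-touches d inc
      -- Exactness fixes the cell and the corner; non-adjacency then fixes the side.
      ... | l , eq , touch′ with unique d l (eq , on-covered⁺ t d (to (∈-glue t d k) f∈T) touch′)
      ... | ≡.refl = ≡.cong (side c)
              (touches-unique (nonAdjacent c) (to (∈-glue t c k) f∈T) j∈t touch′ touch)

  -- Places of a vertex, and complementation of records

  Unshared Shared : Fin #V → Set
  Unshared v = ∃[ p ] cornerAt p ≡ v × (∀ q → cornerAt q ≡ v → q ≡ p)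
  Shared v = ∃[ p ] ∃[ q ] p ≢ q × cornerAt p ≡ v × cornerAt q ≡ v ×
             (∀ r → cornerAt r ≡ v → r ≡ p ⊎ r ≡ q)

  -- The corners of a cell are distinct, so a vertex has exactly one place in each cell containing
  -- it, and there are one or two such cells.
  places : ∀ v → (v ∈ extremal × Unshared v) ⊎ (v ∉ extremal × Shared v)
  -- `cellsAt v` is generalised to a list `cs`, along with every fact needed about it, so that its
  -- length can be analysed by matching.
  places v = go (cellsAt v) (at-least-one v) (at-most-two v)
      (Unique.filter⁺ at? (Unique.allFin⁺ #C)) (λ c∈ → proj₂ (∈-filter⁻ at? {xs = allFin #C} c∈))
      (λ c at → ∈-filter⁺ at? (∈-allFin c) at) extremal⁺ extremal⁻
    where
    at? : Decidable (λ c → ∃[ i ] corner c i ≡ v)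
    at? c = any? λ i → corner c i ≟ᶠ v

    extremal⁺ : length (cellsAt v) ≡ 1 → v ∈ extremal
    extremal⁺ eq = lookup⇒[]= v _
      (≡.trans (lookup∘tabulate _ v) (dec-true (length (cellsAt v) ℕ.≟ 1) eq))

    extremal⁻ : v ∈ extremal → length (cellsAt v) ≡ 1
    extremal⁻ v∈X = invert (≡.subst (Reflects _)
      (≡.trans (≡.sym (lookup∘tabulate (λ u → does (length (cellsAt u) ℕ.≟ 1)) v)) ([]=⇒lookup v∈X))
      (proof (length (cellsAt v) ℕ.≟ 1)))

    go : ∀ cs → 1 ≤ length cs → length cs ≤ 2 → Unique cs →
         (∀ {c} → c List.∈ cs → ∃[ i ] corner c i ≡ v) →
         (∀ c → ∃[ i ] corner c i ≡ v → c List.∈ cs) →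
         (length cs ≡ 1 → v ∈ extremal) → (v ∈ extremal → length cs ≡ 1) →
         (v ∈ extremal × Unshared v) ⊎ (v ∉ extremal × Shared v)
    go (c ∷ []) _ _ _ at all X⁺ _ with at (here ≡.refl)
    ... | i , ≡.refl = inj₁ (X⁺ ≡.refl , (c , i) , ≡.refl , only)
      where
      only : ∀ q → cornerAt q ≡ corner c i → q ≡ (c , i)
      only (d , j) eq with all d (j , eq)
      ... | here ≡.refl = ≡.cong (c ,_) (corner-injective c eq)
    go (c ∷ d ∷ []) _ _ ((c≢d ∷ []) ∷ _) at all _ X⁻ with at (here ≡.refl) | at (there (here ≡.refl))
    ... | i , eqi | j , eqj = inj₂
            ((λ v∈X → contradiction (X⁻ v∈X) λ ())
            , (c , i) , (d , j) , (λ eq → c≢d (≡.cong proj₁ eq)) , eqi , eqj , only)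
      where
      only : ∀ q → cornerAt q ≡ v → q ≡ (c , i) ⊎ q ≡ (d , j)
      only (b , k) eq with all b (k , eq)
      ... | here ≡.refl         = inj₁ (≡.cong (c ,_) (corner-injective c (≡.trans eq (≡.sym eqi))))
      ... | there (here ≡.refl) = inj₂ (≡.cong (d ,_) (corner-injective d (≡.trans eq (≡.sym eqj))))
    go (_ ∷ _ ∷ _ ∷ _) _ (s≤s (s≤s ())) _ _ _ _ _

  -- The relation between `V H` and `V H′`: opposite on the extremal vertices, and both containing
  -- all other vertices. In this form it is symmetric, which lets `exact-∁` serve in both
  -- directions.
  record Complementary (W W′ : Subset #V) : Set where
    field
      disjoint : ∀ {v} → v ∈ extremal → v ∈ W → v ∉ W′
      covering : ∀ {v} → v ∈ extremal → v ∉ W → v ∈ W′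
      innerˡ   : ∀ {v} → v ∉ extremal → v ∈ W
      innerʳ   : ∀ {v} → v ∉ extremal → v ∈ W′

  open Complementary

  complementary-sym : ∀ {W W′} → Complementary W W′ → Complementary W′ W
  complementary-sym {W} {W′} com = record
    { disjoint = λ X ∈W′ ∈W → disjoint com X ∈W ∈W′
    ; covering = covers
    ; innerˡ   = innerʳ com
    ; innerʳ   = innerˡ com
    }
    where
    covers : ∀ {v} → v ∈ extremal → v ∉ W′ → v ∈ W
    covers {v} X ∉W′ with v ∈? W
    ... | yes ∈W = ∈W
    ... | no  ∉W = contradiction (covering com X ∉W) ∉W′

  symmetricDifference-complementary : ∀ {W} → (∀ v → v ∉ W → v ∈ extremal) →
    Complementary W ((W ─ extremal) ∪ (extremal ─ W))
  symmetricDifference-complementary {W} new = record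
    { disjoint = λ X ∈W ∈W′ → apart X ∈W (x∈p∪q⁻ (W ─ extremal) _ ∈W′)
    ; covering = λ X ∉W → x∈p∪q⁺ (inj₂ (x∈p∧x∉q⇒x∈p─q X ∉W))
    ; innerˡ   = inner
    ; innerʳ   = λ ∉X → x∈p∪q⁺ (inj₁ (x∈p∧x∉q⇒x∈p─q (inner ∉X) ∉X))
    }
    where
    inner : ∀ {v} → v ∉ extremal → v ∈ W
    inner {v} ∉X with v ∈? W
    ... | yes ∈W = ∈W
    ... | no  ∉W = contradiction (new v ∉W) ∉X

    apart : ∀ {v} → v ∈ extremal → v ∈ W → ¬ (v ∈ W ─ extremal ⊎ v ∈ extremal ─ W)
    apart X ∈W (inj₁ ∈d) = x∈q⇒x∉p─q X ∈d
    apart X ∈W (inj₂ ∈d) = x∈q⇒x∉p─q ∈W ∈d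

  on-∁ : ∀ b p → On (Vec.map ∁ b) p ⇔ (¬ On b p)
  on-∁ b (c , i) = mk⇔ (x∈∁p⇒x∉p ∘ to (on-map ∁ b c i)) (from (on-map ∁ b c i) ∘ x∉p⇒x∈∁p)

  -- A vertex with two places has exactly one of them in `b`, hence exactly the other in the
  -- complement. An extremal vertex has one place, in `b` iff the vertex is in `W`, hence in the
  -- complement iff it is in `W′`.
  exact-∁ : ∀ {W W′} → Complementary W W′ → ∀ {b} → Exact W b → Exact W′ (Vec.map ∁ b)
  exact-∁ {W} {W′} com {b} (exists , supported) = exists′ , supported′
    where
    exists′ : ∀ v → v ∈ W′ → ∃[ c ] ∃[ i ] (corner c i ≡ v × On (Vec.map ∁ b) (c , i)) ×
                (∀ d j → corner d j ≡ v × On (Vec.map ∁ b) (d , j) → (d , j) ≡ (c , i))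
    exists′ v v∈W′ with places v
    ... | inj₁ (X , p , ≡.refl , only) =
            proj₁ p , proj₂ p
          , (≡.refl , from (on-∁ b p) (λ on → disjoint com X (supported _ _ on) v∈W′))
          , λ d j (eq , _) → only (d , j) eq
    ... | inj₂ (∉X , p , q , p≢q , at-p , at-q , only) with exists v (innerˡ com ∉X)
    ... | c , i , (at , on) , unique with only (c , i) at
    ... | inj₁ ≡.refl = proj₁ q , proj₂ q
          , (at-q , from (on-∁ b q) (λ on-q → p≢q (≡.sym (unique _ _ (at-q , on-q)))))
          , λ d j (eq , off) → other (d , j) off (only (d , j) eq)
      where
      other : ∀ r → On (Vec.map ∁ b) r → r ≡ p ⊎ r ≡ q → r ≡ q
      other r off (inj₁ ≡.refl) = contradiction on (to (on-∁ b r) off)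
      other r off (inj₂ eq)     = eq
    ... | inj₂ ≡.refl = proj₁ p , proj₂ p
          , (at-p , from (on-∁ b p) (λ on-p → p≢q (unique _ _ (at-p , on-p))))
          , λ d j (eq , off) → other (d , j) off (only (d , j) eq)
      where
      other : ∀ r → On (Vec.map ∁ b) r → r ≡ p ⊎ r ≡ q → r ≡ p
      other r off (inj₁ eq)     = eq
      other r off (inj₂ ≡.refl) = contradiction on (to (on-∁ b r) off)

    supported′ : ∀ c i → On (Vec.map ∁ b) (c , i) → corner c i ∈ W′
    supported′ c i off with corner c i ∈? W′ | places (corner c i)
    ... | yes ∈W′ | _ = ∈W′
    ... | no  _   | inj₂ (∉X , _) = innerʳ com ∉X
    -- An extremal vertex outside `W′` lies in `W`, so its only place would be in `b`.
    ... | no  ∉W′ | inj₁ (X , p , _ , only)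
      with exists (corner c i) (covering (complementary-sym com) X ∉W′)
    ... | d , j , (at , on) , _ = contradiction
            (≡.subst (On b) (≡.trans (only (d , j) at) (≡.sym (only (c , i) ≡.refl))) on)
            (to (on-∁ b (c , i)) off)

-- Matching sums over configurations

module SumsOfProducts {c ℓ} (R : CommutativeRing c ℓ) where

  open CommutativeRing R hiding (zero)
  open Matchings R
  open RawSemiringDefs (Semiring.rawSemiring semiring) using (_^_)
  open import Relation.Binary.Reasoning.Setoid setoid
  open CommutativeSemigroupProperties *-commutativeSemigroup using (x∙yz≈y∙xz)
  open BigOp +-commutativeMonoid public renaming
    ( big-cong to ∑-cong; big-ε to ∑-zero; big-↭ to ∑-↭; big-map to ∑-map; big-filter to ∑-filter
    ; big-cartesianProductWith to ∑-cartesianProductWith)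
    using ()
  open BigOp *-commutativeMonoid public renaming
    ( big-cong to ∏-cong; big-↭ to ∏-↭; big-filter to ∏-filter
    ; big-cartesianProductWith to ∏-cartesianProductWith; big-allFin to ∏-allFin)
    using ()

  ∑-distribˡ : ∀ {A : Set} k (xs : List A) f → k * ∑ xs f ≈ ∑ xs (λ x → k * f x)
  ∑-distribˡ k []       f = zeroʳ k
  ∑-distribˡ k (x ∷ xs) f = trans (distribˡ k _ _) (+-congˡ (∑-distribˡ k xs f))

  ∏-zero : ∀ {A : Set} {x} {xs : List A} f → x List.∈ xs → f x ≈ 0# → ∏ xs f ≈ 0#
  ∏-zero f (here ≡.refl) eq = trans (*-congʳ eq) (zeroˡ _)
  ∏-zero f (there x∈)    eq = trans (*-congˡ (∏-zero f x∈ eq)) (zeroʳ _)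

  ∑-filter-* : ∀ {A : Set} {p} {P : Pred A p} (P? : Decidable P) xs (f g : A → Carrier) →
    ∑ xs (λ x → (if does (P? x) then f x else 0#) * g x) ≈ ∑ (filter P? xs) (λ x → f x * g x)
  ∑-filter-* P? xs f g = trans (∑-cong xs λ x → cut (does (P? x)) x) (sym (∑-filter P? xs _))
    where
    cut : ∀ b x → (if b then f x else 0#) * g x ≈ (if b then f x * g x else 0#)
    cut true  x = refl
    cut false x = zeroˡ _

  -- Separates the product of all cell factors into the power of 2 from the partial cells and the
  -- product of `Δ` over the whole cells.
  ∏-if-constant : ∀ {A : Set} {p} {P : Pred A p} (P? : Decidable P) xs f k →
    ∏ xs (λ x → if does (P? x) then f x else k) ≈
    k ^ length (filter (λ x → ¬? (P? x)) xs) * ∏ (filter P? xs) f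
  ∏-if-constant P? []       f k = sym (*-identityˡ 1#)
  ∏-if-constant P? (x ∷ xs) f k with does (P? x)
  ... | true  = trans (*-congˡ (∏-if-constant P? xs f k))
                  (x∙yz≈y∙xz _ _ _)
  ... | false = trans (*-congˡ (∏-if-constant P? xs f k)) (sym (*-assoc _ _ _))

  if-yes : ∀ {p} {P : Set p} (P? : Dec P) {x y : Carrier} → P → (if does P? then x else y) ≈ x
  if-yes P? {x} {y} p = reflexive (≡.cong (λ b → if b then x else y) (dec-true P? p))

  if-no : ∀ {p} {P : Set p} (P? : Dec P) {x y : Carrier} → ¬ P → (if does P? then x else y) ≈ y
  if-no P? {x} {y} ¬p = reflexive (≡.cong (λ b → if b then x else y) (dec-false P? ¬p))

  -- Sums over vectors with local weights

  module _ {S B : Set} (xs : List S) where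

    -- The local weights `w` multiply independently; the coordinates interact only through `φ`,
    -- which sees each of them through `β`.
    vectorSum : ∀ n (w : Fin n → S → Carrier) (β : S → B) (φ : Vec B n → Carrier) → Carrier
    vectorSum n w β φ =
      ∑ (vectors xs n) λ t → ∏ (allFin n) (λ c → w c (lookup t c)) * φ (Vec.map β t)

    vectorSum-suc : ∀ n w β φ →
      vectorSum (suc n) w β φ ≈
      ∑ xs (λ s → w zero s * vectorSum n (w ∘ suc) β (λ b → φ (β s ∷ b)))
    vectorSum-suc n w β φ = trans (∑-cartesianProductWith _∷_ xs (vectors xs n) _)
      (∑-cong xs λ s → trans
        (∑-cong (vectors xs n) λ t → trans (*-congʳ (∏-allFin n _)) (*-assoc _ _ _))
        (sym (∑-distribˡ _ (vectors xs n) _)))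

    -- φ couples the cells, so the local identity is applied to one cell with the other cells frozen.
    transfer : ∀ n (w w′ : Fin n → S → Carrier) (κ : Fin n → Carrier) (β β′ : S → B)
      (Null : Fin n → B → Set) →
      (∀ c (ψ : B → Carrier) → (∀ b → Null c b → ψ b ≈ 0#) →
        ∑ xs (λ s → w c s * ψ (β s)) ≈ κ c * ∑ xs (λ s → w′ c s * ψ (β′ s))) →
      ∀ (φ : Vec B n → Carrier) → (∀ b c → Null c (lookup b c) → φ b ≈ 0#) →
      vectorSum n w β φ ≈ ∏ (allFin n) κ * vectorSum n w′ β′ φ
    transfer zero    w w′ κ β β′ Null local φ null = sym (*-identityˡ _)
    transfer (suc n) w w′ κ β β′ Null local φ null = begin
      vectorSum (suc n) w β φ
        ≈⟨ vectorSum-suc n w β φ ⟩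
      ∑ xs (λ s → w zero s * vectorSum n (w ∘ suc) β (λ b → φ (β s ∷ b)))
        ≈⟨ local zero (λ b₀ → vectorSum n (w ∘ suc) β (λ b → φ (b₀ ∷ b)))
             -- A null first entry makes every summand of the remaining sum vanish.
             (λ b₀ bad → ∑-zero (vectors xs n) λ t →
               trans (*-congˡ (null (b₀ ∷ Vec.map β t) zero bad)) (zeroʳ _)) ⟩
      κ zero * ∑ xs (λ s → w′ zero s * vectorSum n (w ∘ suc) β (λ b → φ (β′ s ∷ b)))
        ≈⟨ *-congˡ (∑-cong xs λ s → trans
             (*-congˡ (transfer n (w ∘ suc) (w′ ∘ suc) (κ ∘ suc) β β′ (Null ∘ suc) (local ∘ suc)
               (λ b → φ (β′ s ∷ b)) (λ b c → null (β′ s ∷ b) (suc c))))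
             (x∙yz≈y∙xz _ _ _)) ⟩
      κ zero * ∑ xs (λ s → ∏ (allFin n) (κ ∘ suc) *
                 (w′ zero s * vectorSum n (w′ ∘ suc) β′ (λ b → φ (β′ s ∷ b))))
        ≈⟨ *-congˡ (∑-distribˡ _ xs _) ⟨
      κ zero * (∏ (allFin n) (κ ∘ suc) *
                 ∑ xs (λ s → w′ zero s * vectorSum n (w′ ∘ suc) β′ (λ b → φ (β′ s ∷ b))))
        ≈⟨ *-assoc _ _ _ ⟨
      κ zero * ∏ (allFin n) (κ ∘ suc) *
                 ∑ xs (λ s → w′ zero s * vectorSum n (w′ ∘ suc) β′ (λ b → φ (β′ s ∷ b)))
        ≈⟨ *-cong (∏-allFin n κ) (vectorSum-suc n w′ β′ φ) ⟨
      ∏ (allFin (suc n)) κ * vectorSum (suc n) w′ β′ φ ∎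

  -- Matchings of a single cell

  indicator : ∀ {p} {P : Set p} → Dec P → Carrier
  indicator P? = if does P? then 1# else 0#

  -- Sets that are not matchings weigh 0, so the local condition is absorbed into the weight and
  -- sums can run over all of `subsets 4`.
  matchingWeight : (Fin 4 → Carrier) → Subset 4 → Carrier
  matchingWeight u s = if does (nonAdjacent? s) then ∏ (filter (_∈? s) (allFin 4)) u else 0#

  matchingWeight-nonAdjacent : ∀ u {s} → NonAdjacent s →
    matchingWeight u s ≈ ∏ (filter (_∈? s) (allFin 4)) u
  matchingWeight-nonAdjacent u {s} nonAdjacent = if-yes (nonAdjacent? s) nonAdjacent

  matchingWeight-adjacent : ∀ u {s} → ¬ NonAdjacent s → matchingWeight u s ≈ 0#
  matchingWeight-adjacent u {s} adjacent = if-no (nonAdjacent? s) adjacent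

  matchingWeight-cong : ∀ {u v} s → (∀ i → u i ≈ v i) → matchingWeight u s ≈ matchingWeight v s
  matchingWeight-cong s eq with does (nonAdjacent? s)
  ... | true  = ∏-cong (filter (_∈? s) (allFin 4)) eq
  ... | false = refl

  -- The generating function of the two perfect matchings of the 4-cycle.
  pairWeight : (Fin 4 → Carrier) → Carrier
  pairWeight u = u 0F * u 2F + u 1F * u 3F

  matchingWeight-sum : ∀ u (g : Subset 4 → Carrier) →
    ∑ (subsets 4) (λ s → matchingWeight u s * g (covered s)) ≈
    g ⊥ + (u 0F * g (covered ⁅ 0F ⁆) + u 1F * g (covered ⁅ 1F ⁆) +
           u 2F * g (covered ⁅ 2F ⁆) + u 3F * g (covered ⁅ 3F ⁆)) + pairWeight u * g ⊤
  matchingWeight-sum u g =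
    -- filter nonAdjacent? (subsets 4) evaluates to {0,2}, {0}, {1,3}, {1}, {2}, {3}, ∅.
    trans (∑-filter-* nonAdjacent? (subsets 4) (λ s → ∏ (filter (_∈? s) (allFin 4)) u) (g ∘ covered))
      (solve 10 (λ a b c d g₀ g₁ g₂ g₃ g⊥ g⊤ →
        (a :* (c :* con 1)) :* g⊤ :+ ((a :* con 1) :* g₀ :+ ((b :* (d :* con 1)) :* g⊤ :+
          ((b :* con 1) :* g₁ :+ ((c :* con 1) :* g₂ :+ ((d :* con 1) :* g₃ :+ (con 1 :* g⊥ :+ con 0))))))
        := g⊥ :+ (a :* g₀ :+ b :* g₁ :+ c :* g₂ :+ d :* g₃) :+ (a :* c :+ b :* d) :* g⊤)
        refl (u 0F) (u 1F) (u 2F) (u 3F) (g (covered ⁅ 0F ⁆)) (g (covered ⁅ 1F ⁆))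
        (g (covered ⁅ 2F ⁆)) (g (covered ⁅ 3F ⁆)) (g ⊥) (g ⊤))
    where open Solver commutativeSemiring

  -- Complementing corner sets exchanges `⊥` with `⊤` and the ends of side `i` with those of
  -- `opp i`; the three hypotheses compare the coefficients of `ψ` at these sets. The last two keep
  -- the factor `ψ` so that they also hold where `ψ` vanishes.
  cell-complementation : ∀ κ u u′ ψ →
    1# ≈ κ * pairWeight u′ →
    (∀ i → u i * ψ (covered ⁅ i ⁆) ≈ κ * u′ (opp i) * ψ (covered ⁅ i ⁆)) →
    pairWeight u * ψ ⊤ ≈ κ * ψ ⊤ →
    ∑ (subsets 4) (λ s → matchingWeight u s * ψ (covered s)) ≈
    κ * ∑ (subsets 4) (λ s → matchingWeight u′ s * ψ (∁ (covered s)))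
  cell-complementation κ u u′ ψ empty single full = begin
    ∑ (subsets 4) (λ s → matchingWeight u s * ψ (covered s))
      ≈⟨ matchingWeight-sum u ψ ⟩
    ψ ⊥ + (u 0F * ψ₀ + u 1F * ψ₁ + u 2F * ψ₂ + u 3F * ψ₃) + pairWeight u * ψ ⊤
      ≈⟨ +-cong (+-cong (trans (sym (*-identityˡ _)) (*-congʳ empty))
           (+-cong (+-cong (+-cong (single 0F) (single 1F)) (single 2F)) (single 3F))) full ⟩
    κ * pairWeight u′ * ψ ⊥ + (κ * u′ 2F * ψ₀ + κ * u′ 3F * ψ₁ + κ * u′ 0F * ψ₂ + κ * u′ 1F * ψ₃) + κ * ψ ⊤
      ≈⟨ solve 12 (λ k a b c d ψ₀ ψ₁ ψ₂ ψ₃ ψ⊥ ψ⊤ p →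
           k :* p :* ψ⊥ :+ (k :* c :* ψ₀ :+ k :* d :* ψ₁ :+ k :* a :* ψ₂ :+ k :* b :* ψ₃) :+ k :* ψ⊤
           := k :* (ψ⊤ :+ (a :* ψ₂ :+ b :* ψ₃ :+ c :* ψ₀ :+ d :* ψ₁) :+ p :* ψ⊥))
           refl κ (u′ 0F) (u′ 1F) (u′ 2F) (u′ 3F) ψ₀ ψ₁ ψ₂ ψ₃ (ψ ⊥) (ψ ⊤) (pairWeight u′) ⟩
    κ * (ψ ⊤ + (u′ 0F * ψ₂ + u′ 1F * ψ₃ + u′ 2F * ψ₀ + u′ 3F * ψ₁) + pairWeight u′ * ψ ⊥)
      ≈⟨ *-congˡ (matchingWeight-sum u′ (ψ ∘ ∁)) ⟨
    κ * ∑ (subsets 4) (λ s → matchingWeight u′ s * ψ (∁ (covered s))) ∎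
    where
    open Solver commutativeSemiring
    ψ₀ = ψ (covered ⁅ 0F ⁆)
    ψ₁ = ψ (covered ⁅ 1F ⁆)
    ψ₂ = ψ (covered ⁅ 2F ⁆)
    ψ₃ = ψ (covered ⁅ 3F ⁆)

  -- The matching generating function as a sum over cells

  module _ {G : Graph} (𝒢 : Cellular G) where

    open Graph G
    open Cellular 𝒢
    open Configurations 𝒢

    ∏-glue : ∀ t (wt : Fin #E → Carrier) →
      ∏ (filter (_∈? glue t) (allFin #E)) wt ≈
      ∏ (allFin #C) (λ c → ∏ (filter (_∈? lookup t c) (allFin 4)) (wt ∘ side c))
    ∏-glue t wt = begin
      ∏ (filter (_∈? glue t) (allFin #E)) wt
        ≈⟨ ∏-filter (_∈? glue t) (allFin #E) wt ⟩
      ∏ (allFin #E) chosen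
        ≈⟨ ∏-↭ chosen edges↭ ⟩
      ∏ (cartesianProductWith side (allFin #C) (allFin 4)) chosen
        ≈⟨ ∏-cartesianProductWith side (allFin #C) (allFin 4) chosen ⟩
      ∏ (allFin #C) (λ c → ∏ (allFin 4) (chosen ∘ side c))
        ≈⟨ ∏-cong (allFin #C) (λ c → ∏-cong (allFin 4) λ i → reflexive
             (≡.cong (λ b → if b then wt (side c i) else 1#)
               (does-⇔ (∈-glue t c i) (side c i ∈? glue t) (i ∈? lookup t c)))) ⟩
      ∏ (allFin #C) (λ c → ∏ (allFin 4) (λ i → if does (i ∈? lookup t c) then wt (side c i) else 1#))
        ≈⟨ ∏-cong (allFin #C) (λ c → ∏-filter (_∈? lookup t c) (allFin 4) (wt ∘ side c)) ⟨
      ∏ (allFin #C) (λ c → ∏ (filter (_∈? lookup t c) (allFin 4)) (wt ∘ side c)) ∎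
      where
      chosen : Fin #E → Carrier
      chosen e = if does (e ∈? glue t) then wt e else 1#

      edges↭ : allFin #E ↭ cartesianProductWith side (allFin #C) (allFin 4)
      edges↭ = complete-↭ (Unique.allFin⁺ #E)
        (Unique.cartesianProductWith⁺ side (,-injective ∘ sideAt-injective)
          (Unique.allFin⁺ #C) (Unique.allFin⁺ 4))
        ∈-allFin
        (λ e → ≡.subst (List._∈ _) (sideAt-position e)
          (∈-cartesianProductWith⁺ side (∈-allFin (proj₁ (position e))) (∈-allFin (proj₂ (position e)))))

    subsets↭ : subsets #E ↭ map glue (vectors (subsets 4) #C)
    subsets↭ = complete-↭ (subsets-unique #E)
      (Unique.map⁺ glue-injective (vectors-unique (subsets-unique 4) #C))
      subsets-complete
      λ T → let t , eq = glue-surjective T in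
        ≡.subst (List._∈ _) eq (∈-map⁺ glue (vectors-complete subsets-complete t))

    cellWeight : (Fin #E → Carrier) → Fin #C → Subset 4 → Carrier
    cellWeight wt c = matchingWeight (wt ∘ side c)

    perfect-weight : ∀ W wt t →
      (if does (isPerfectMatching? (induced {G} W) (glue t))
        then ∏ (filter (_∈? glue t) (allFin #E)) wt else 0#) ≈
      ∏ (allFin #C) (λ c → cellWeight wt c (lookup t c)) * indicator (exact? W (Vec.map covered t))
    perfect-weight W wt t =
      by-cases (isPerfectMatching? (induced {G} W) (glue t)) (exact? W (Vec.map covered t))
      where
      by-cases : (perfect? : Dec (IsPerfectMatching (induced {G} W) (glue t)))
        (exact-dec : Dec (Exact W (Vec.map covered t))) →
        (if does perfect? then ∏ (filter (_∈? glue t) (allFin #E)) wt else 0#) ≈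
        ∏ (allFin #C) (λ c → cellWeight wt c (lookup t c)) * indicator exact-dec
      by-cases (yes perfect) (yes exact) = begin
        ∏ (filter (_∈? glue t) (allFin #E)) wt
          ≈⟨ ∏-glue t wt ⟩
        ∏ (allFin #C) (λ c → ∏ (filter (_∈? lookup t c) (allFin 4)) (wt ∘ side c))
          ≈⟨ ∏-cong (allFin #C) (λ c →
               matchingWeight-nonAdjacent (wt ∘ side c) (proj₂ (perfect⇒exact W t perfect) c)) ⟨
        ∏ (allFin #C) (λ c → cellWeight wt c (lookup t c))
          ≈⟨ *-identityʳ _ ⟨
        ∏ (allFin #C) (λ c → cellWeight wt c (lookup t c)) * 1# ∎
      by-cases (yes perfect) (no inexact) = contradiction (proj₁ (perfect⇒exact W t perfect)) inexact
      -- Some cell contains two adjacent chosen sides, and its weight 0 annihilates the product.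
      by-cases (no imperfect) (yes exact)
        with ¬∀⟶∃¬ #C _ (λ c → nonAdjacent? (lookup t c)) (imperfect ∘ exact⇒perfect W t exact)
      ... | c , adjacent = sym (trans
        (*-congʳ (∏-zero _ (∈-allFin c) (matchingWeight-adjacent (wt ∘ side c) adjacent))) (zeroˡ _))
      by-cases (no _) (no _) = sym (zeroʳ _)

    M-induced : ∀ W wt → M {G} (induced W) wt ≈
      vectorSum (subsets 4) #C (cellWeight wt) covered (λ b → indicator (exact? W b))
    M-induced W wt = begin
      M {G} (induced W) wt
        ≈⟨ ∑-filter (isPerfectMatching? (induced {G} W)) (subsets #E) weight ⟩
      ∑ (subsets #E) term
        ≈⟨ ∑-↭ term subsets↭ ⟩
      ∑ (map glue (vectors (subsets 4) #C)) term
        ≈⟨ ∑-map glue (vectors (subsets 4) #C) term ⟩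
      ∑ (vectors (subsets 4) #C) (term ∘ glue)
        ≈⟨ ∑-cong (vectors (subsets 4) #C) (perfect-weight W wt) ⟩
      vectorSum (subsets 4) #C (cellWeight wt) covered (λ b → indicator (exact? W b)) ∎
      where
      weight term : Subset #E → Carrier
      weight T = ∏ (filter (_∈? T) (allFin #E)) wt
      term T = if does (isPerfectMatching? (induced {G} W) T) then weight T else 0#

-- Complementation

module Complementation {G : Graph} {a ℓ₁ ℓ₂ : Level} {H : Subgraph G}
       {K : RationalFunctionField (Edge H) a ℓ₁ ℓ₂}
       (𝒢 : CellularCompletion H K) where

  open Completion 𝒢
  open Graph G
  open Configurations cellular
  open SumsOfProducts ring
  open RationalFunctionProperties K using (2#0)
  open CommutativeRing ring using (commutativeSemiring)
  open RingProperties (CommutativeRing.ring ring) using (-0#≈0#)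
  open import Relation.Binary.Reasoning.Setoid setoid
  open Solver commutativeSemiring using (solve; _:=_; _:+_; _:*_)

  -- The element `y ⁻¹[ y#0 ]` is given as an inverse of `y - 0#`, so the `0#` has to be removed.
  ⁻¹-inverseʳ : ∀ {y} (y#0 : y # 0#) → y * y ⁻¹[ y#0 ] ≈ 1#
  ⁻¹-inverseʳ {y} y#0 = trans
    (*-congʳ (sym (trans (+-congˡ -0#≈0#) (+-identityʳ y))))
    (proj₂ (proj₂ (#⇒invertible y#0)))

  -- `H` need not be induced, but the extra edges of the induced subgraph have weight 0, so a
  -- matching using one contributes nothing.
  M-induced-V : M H wt ≈ M {G} (induced (V H)) wt
  M-induced-V = trans (∑-filter (isPerfectMatching? H) (subsets #E) weight)
    (trans (∑-cong (subsets #E) λ T →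
             by-cases T (isPerfectMatching? H T) (isPerfectMatching? (induced {G} (V H)) T))
      (sym (∑-filter (isPerfectMatching? (induced {G} (V H))) (subsets #E) weight)))
    where
    weight : Subset #E → Carrier
    weight T = ∏ (filter (_∈? T) (allFin #E)) wt

    E⊆induced : ∀ {e} → e ∈ E H → e ∈ E (induced {G} (V H))
    E⊆induced e∈H = ∈-induced {G} (V H) (proj₁ (closed H e∈H)) (proj₂ (closed H e∈H))

    by-cases : ∀ T (d : Dec (IsPerfectMatching H T))
      (d′ : Dec (IsPerfectMatching (induced {G} (V H)) T)) →
      (if does d then weight T else 0#) ≈ (if does d′ then weight T else 0#)
    by-cases T (yes _) (yes _) = refl
    by-cases T (no _)  (no _)  = refl
    by-cases T (yes (T⊆E , perfect)) (no imperfect) =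
      ⊥-elim (imperfect ((λ e∈T → E⊆induced (T⊆E e∈T)) , perfect))
    by-cases T (no imperfect) (yes (T⊆E , perfect))
      with ¬∀⟶∃¬ #E _ (λ e → (e ∈? T) →-dec (e ∈? E H))
             (λ T⊆H → imperfect ((λ {e} → T⊆H e) , perfect))
    ... | e , escapes with e ∈? T
    ... | no  e∉T = contradiction (λ e∈T → contradiction e∈T e∉T) escapes
    ... | yes e∈T = sym (∏-zero wt (∈-filter⁺ (_∈? T) (∈-allFin e) e∈T)
      (wt-zero e (λ e∈H → escapes λ _ → e∈H)
        (proj₁ (closed (induced {G} (V H)) (T⊆E e∈T)))
        (proj₂ (closed (induced {G} (V H)) (T⊆E e∈T)))))

  wt₁-side : ∀ c i → wt₁ (side c i) ≡ sideWeight c i (whole? c)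
  wt₁-side c i =
    ≡.cong (λ p → sideWeight (proj₁ p) (proj₂ p) (whole? (proj₁ p))) (position-sideAt (c , i))

  cellFactor : ∀ c → Dec (Whole c) → Carrier
  cellFactor c whole = if does whole then Δ c else 2#

  -- No exact configuration for V H restricts to such an s on c.
  Null : Fin #C → Subset 4 → Set
  Null c s = ∃[ i ] corner c i ∉ V H × i ∈ s

  -- The product of the weights of two opposite sides is always 1/4, either as 1/(2x) times x/2 or
  -- as 1/2 times 1/2.
  partialWeight-product : ∀ {e f} (d : Dec (e ∈ E H)) (d′ : Dec (f ∈ E H)) →
    ¬ (e ∈ E H × f ∈ E H) → 2# * (partialWeight d d′ * partialWeight d′ d) ≈ 2# ⁻¹[ 2#0 ]
  partialWeight-product (yes p) (yes q) not-both = contradiction (p , q) not-both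
  partialWeight-product {e} (yes p) (no _) _ = begin
    2# * (x⁻¹ * (wt e * h)) ≈⟨ solve 4 (λ t z x h → t :* (z :* (x :* h)) := (t :* x) :* z :* h)
                                 refl 2# x⁻¹ (wt e) h ⟩
    2# * wt e * x⁻¹ * h     ≈⟨ *-congʳ (⁻¹-inverseʳ _) ⟩
    1# * h                  ≈⟨ *-identityˡ h ⟩
    h                       ∎
    where
    h x⁻¹ : Carrier
    h = 2# ⁻¹[ 2#0 ]
    x⁻¹ = (2# * wt e) ⁻¹[ *-#0 2#0 (wt#0 p) ]
  partialWeight-product {e} {f} d@(no ¬p) d′@(yes q) not-both =
    trans (*-congˡ (*-comm (partialWeight d d′) (partialWeight d′ d)))
      (partialWeight-product d′ d λ (q , p) → not-both (p , q))
  partialWeight-product (no _) (no _) _ =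
    trans (sym (*-assoc _ _ _)) (trans (*-congʳ (⁻¹-inverseʳ 2#0)) (*-identityˡ _))

  -- Comparison of local sums, first in partial cells

  module _ (covering : VerticesCoveredInCells) where

    module _ {c} (partial : ¬ Whole c) where

      not-opposite : ∀ i → ¬ Both c i
      not-opposite i (p , q) = partial λ k → cover k (opposite-sides-touch i k)
        where
        cover : ∀ k → Touches i k ⊎ Touches (opp i) k → Covered c k
        cover k (inj₁ touch) = i , p , touches-incident c touch
        cover k (inj₂ touch) = opp i , q , touches-incident c touch

      -- Corners in `V H` are covered by hypothesis, so an uncovered corner lies outside. Hence no
      -- exact configuration for `V H` has all four corners of a partial cell.
      missing-corner : ∃[ i ] corner c i ∉ V H
      missing-corner
        with ¬∀⟶∃¬ 4 _ (λ i → any? λ j →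
               (side c j ∈? E H) ×-dec incident? G (side c j) (corner c i)) partial
      ... | i , uncovered = i , λ ∈V → uncovered (covering c i ∈V)

      -- If both ends of side i were in V H, the two sides adjacent to it would be in E H.
      missing-end : ∀ i → side c i ∉ E H → Null c (covered ⁅ i ⁆)
      missing-end i i∉H with corner c i ∈? V H | corner c (next i) ∈? V H
      ... | no ∉V | _     = i , ∉V , ∈-covered⁺ (x∈⁅x⁆ i) (inj₁ ≡.refl)
      ... | _     | no ∉V = next i , ∉V , ∈-covered⁺ (x∈⁅x⁆ i) (inj₂ ≡.refl)
      ... | yes p | yes q
        with covering-side {c} {i} (covering c (next i) q)
           | covering-side {c} {opp (next i)}
               (≡.subst (Covered c) (≡.sym (opp-involutive i)) (covering c i p))
      ... | inj₁ i∈H | _        = contradiction i∈H i∉H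
      ... | inj₂ _   | inj₂ i∈H = contradiction (≡.subst (λ j → side c j ∈ E H) (opp-involutive i) i∈H) i∉H
      ... | inj₂ b   | inj₁ b′  = contradiction (b , b′) (not-opposite (next i))

      partial-empty : 1# ≈ 2# * pairWeight (λ i → sideWeight c i (no partial))
      partial-empty = sym (begin
        2# * (w 0F * w 2F + w 1F * w 3F)
          ≈⟨ distribˡ 2# _ _ ⟩
        2# * (w 0F * w 2F) + 2# * (w 1F * w 3F)
          ≈⟨ +-cong (partialWeight-product (side c 0F ∈? E H) (side c 2F ∈? E H) (not-opposite 0F))
                    (partialWeight-product (side c 1F ∈? E H) (side c 3F ∈? E H) (not-opposite 1F)) ⟩
        h + h
          ≈⟨ +-cong (*-identityˡ h) (*-identityˡ h) ⟨
        1# * h + 1# * h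
          ≈⟨ distribʳ h 1# 1# ⟨
        2# * h
          ≈⟨ ⁻¹-inverseʳ 2#0 ⟩
        1# ∎)
        where
        h : Carrier
        h = 2# ⁻¹[ 2#0 ]
        w : Fin 4 → Carrier
        w i = sideWeight c i (no partial)

      partial-opposite : ∀ i → side c i ∈ E H → wt (side c i) ≈ 2# * sideWeight c (opp i) (no partial)
      -- The weight of side `opp i` also inspects side `opp (opp i)`, which is turned into `i`.
      partial-opposite i i∈H rewrite opp-involutive i with side c (opp i) ∈? E H | side c i ∈? E H
      ... | yes q | _      = contradiction (i∈H , q) (not-opposite i)
      ... | no _  | no i∉H = contradiction i∈H i∉H
      ... | no _  | yes _  = begin
        x               ≈⟨ *-identityʳ x ⟨
        x * 1#          ≈⟨ *-congˡ (⁻¹-inverseʳ 2#0) ⟨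
        x * (2# * h)    ≈⟨ solve 3 (λ x t h → x :* (t :* h) := t :* (x :* h)) refl x 2# h ⟩
        2# * (x * h)    ∎
        where
        h x : Carrier
        h = 2# ⁻¹[ 2#0 ]
        x = wt (side c i)

    -- In a whole cell the new weights are the opposite ones over `Δ c`, and the new `pairWeight` is
    -- 1/Δ. In a partial cell the coefficients agree at `⊥` and at the ends of sides in `H`; at `⊤`
    -- and at the ends of the other sides `ψ` vanishes.
    cell-identity : ∀ c (whole : Dec (Whole c)) (ψ : Subset 4 → Carrier) →
      (∀ s → Null c s → ψ s ≈ 0#) →
      ∑ (subsets 4) (λ s → matchingWeight (wt ∘ side c) s * ψ (covered s)) ≈
      cellFactor c whole *
        ∑ (subsets 4) (λ s → matchingWeight (λ i → sideWeight c i whole) s * ψ (∁ (covered s)))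
    cell-identity c (yes w) ψ _ = cell-complementation (Δ c) x (λ i → sideWeight c i (yes w)) ψ
      (sym (begin
        Δ c * (x 2F * d * (x 0F * d) + x 3F * d * (x 1F * d))
          ≈⟨ solve 5 (λ a b c e d → (a :* c :+ b :* e) :* (c :* d :* (a :* d) :+ e :* d :* (b :* d))
                       := ((a :* c :+ b :* e) :* d) :* ((a :* c :+ b :* e) :* d))
                       refl (x 0F) (x 1F) (x 2F) (x 3F) d ⟩
        (Δ c * d) * (Δ c * d)
          ≈⟨ *-cong (⁻¹-inverseʳ (Δ#0 c w)) (⁻¹-inverseʳ (Δ#0 c w)) ⟩
        1# * 1#
          ≈⟨ *-identityˡ 1# ⟩
        1# ∎))
      (λ i → *-congʳ (sym (begin
        Δ c * (x (opp (opp i)) * d) ≡⟨ ≡.cong (λ j → Δ c * (x j * d)) (opp-involutive i) ⟩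
        Δ c * (x i * d)             ≈⟨ solve 3 (λ t x d → t :* (x :* d) := x :* (t :* d))
                                         refl (Δ c) (x i) d ⟩
        x i * (Δ c * d)             ≈⟨ *-congˡ (⁻¹-inverseʳ (Δ#0 c w)) ⟩
        x i * 1#                    ≈⟨ *-identityʳ _ ⟩
        x i                         ∎)))
      -- `Δ c` is by definition `pairWeight x`.
      refl
      where
      x : Fin 4 → Carrier
      x = wt ∘ side c
      d : Carrier
      d = Δ c ⁻¹[ Δ#0 c w ]
    cell-identity c (no partial) ψ null =
      cell-complementation 2# (wt ∘ side c) (λ i → sideWeight c i (no partial)) ψ
      (partial-empty partial) single
      (vanish (let i , ∉V = missing-corner partial in i , ∉V , ∈⊤))
      where
      vanish : ∀ {s k l} → Null c s → k * ψ s ≈ l * ψ s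
      vanish {s} bad = trans (kill _) (sym (kill _))
        where
        kill : ∀ k → k * ψ s ≈ 0#
        kill k = trans (*-congˡ (null s bad)) (zeroʳ k)

      single : ∀ i → wt (side c i) * ψ (covered ⁅ i ⁆) ≈
                     2# * sideWeight c (opp i) (no partial) * ψ (covered ⁅ i ⁆)
      single i with side c i ∈? E H
      ... | yes i∈H = *-congʳ (partial-opposite partial i i∈H)
      ... | no  i∉H = vanish (missing-end partial i i∉H)

    complementary : Complementary (V H) (V H′)
    complementary = symmetricDifference-complementary new⊆extremal

    cell-identity-wt₁ : ∀ c (ψ : Subset 4 → Carrier) → (∀ s → Null c s → ψ s ≈ 0#) →
      ∑ (subsets 4) (λ s → cellWeight cellular wt c s * ψ (covered s)) ≈
      cellFactor c (whole? c) * ∑ (subsets 4) (λ s → cellWeight cellular wt₁ c s * ψ (∁ (covered s)))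
    cell-identity-wt₁ c ψ null = trans (cell-identity c (whole? c) ψ null)
      (*-congˡ (∑-cong (subsets 4) λ s → *-congʳ {ψ (∁ (covered s))}
        (matchingWeight-cong s λ i → reflexive (≡.sym (wt₁-side c i)))))

    -- `exact-∁` applies in both directions, and complementing twice changes nothing.
    indicator-∁ : ∀ b → indicator (exact? (V H) (Vec.map ∁ b)) ≈ indicator (exact? (V H′) b)
    indicator-∁ b = reflexive (≡.cong (λ x → if x then 1# else 0#)
      (does-⇔ (mk⇔
        (λ exact → ≡.subst (Exact (V H′))
          (≡.trans (≡.sym (map-∘ ∁ ∁ b)) (≡.trans (map-cong ∁-involutive b) (map-id b)))
          (exact-∁ complementary {Vec.map ∁ b} exact))
        (exact-∁ (complementary-sym complementary) {b}))
        (exact? (V H) (Vec.map ∁ b)) (exact? (V H′) b)))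

    complementation : M H wt ≈ ((2# ^ length 𝒞₀) * ∏ 𝒞₁ Δ) * M H′ wt₁
    complementation = begin
      M H wt
        ≈⟨ M-induced-V ⟩
      M {G} (induced (V H)) wt
        ≈⟨ M-induced cellular (V H) wt ⟩
      vectorSum (subsets 4) #C (cellWeight cellular wt) covered φ
        ≈⟨ transfer (subsets 4) #C (cellWeight cellular wt) (cellWeight cellular wt₁)
             (λ c → cellFactor c (whole? c)) covered (∁ ∘ covered) Null cell-identity-wt₁ φ
             -- An exact configuration is supported on `V H`, so `φ` vanishes as soon as one cell is
             -- null.
             (λ b c (i , ∉V , on) → if-no (exact? (V H) b) λ (_ , supported) → ∉V (supported c i on)) ⟩
      ∏ (allFin #C) (λ c → cellFactor c (whole? c)) *
        vectorSum (subsets 4) #C (cellWeight cellular wt₁) (∁ ∘ covered) φ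
        -- The complement is moved from the record into `φ`, which becomes the exactness test for
        -- `V H′`.
        ≈⟨ *-cong (∏-if-constant whole? (allFin #C) Δ 2#)
             (trans (∑-cong (vectors (subsets 4) #C) λ t → *-congˡ (trans
               (reflexive (≡.cong φ (map-∘ ∁ covered t))) (indicator-∁ (Vec.map covered t))))
               (sym (M-induced cellular (V H′) wt₁))) ⟩
      ((2# ^ length 𝒞₀) * ∏ 𝒞₁ Δ) * M H′ wt₁ ∎
      where
      φ : Config → Carrier
      φ b = indicator (exact? (V H) b)

theorem2p3 :
    ∀ {a ℓ₁ ℓ₂ : Level} {G : Graph} (H : Subgraph G)
      (K : RationalFunctionField (Edge H) a ℓ₁ ℓ₂)
      (𝒢 : CellularCompletion H K) →
    let open Completion 𝒢 in
    EveryCellMeetsH →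
    VerticesCoveredInCells →
    M H wt ≈ ((2# ^ length 𝒞₀) * ∏ 𝒞₁ Δ) * M H′ wt₁
theorem2p3 H K 𝒢 _ covering = Complementation.complementation 𝒢 covering
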